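{- For fixed positive integers $m$ and $s$ there exist positive constants $c=c(m,s)$ and $C=C(m,s)$, independent of $n$, such that for all sufficiently large $n$, $$c\,n\le r_{\Delta}(K_{m,n};s)\le br_{\Delta}(K_{m,n};s)\le C\,n.$$
   Context: For graphs $H$ and $G$ and a positive integer $s$, write $H\xrightarrow{s} G$ if every coloring of the edges of $H$ with $s$ colors contains a monochromatic subgraph isomorphic to $G$. The degree Ramsey number is $r_{\Delta}(G;s)=\min\{\Delta(H): H\xrightarrow{s} G\}$ and the degree bipartite Ramsey number is $br_{\Delta}(G;s)=\min\{\Delta(H): H \text{ is bipartite and } H\xrightarrow{s} G\}$, where $\Delta(H)$ denotes the maximum degree of $H$. $K_{m,n}$ is the complete bipartite graph with parts of sizes $m$ and $n$. -}

module Defs where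

open import Data.Bool using (Bool; true; false; T)
open import Data.Fin using (Fin; splitAt)
open import Data.Fin.Subset using (Subset; ∣_∣)
open import Data.Integer using (+_)
open import Data.List using (map; allFin)
open import Data.List.Extrema.Nat using (max)
open import Data.Nat using (ℕ; _+_; _≤_)
open import Data.Product using (Σ; ∃-syntax; _×_)
open import Data.Rational using (ℚ; _/_)
open import Data.Sum using (_⊎_; inj₁; inj₂)
open import Data.Vec using (tabulate)
open import Function.Definitions using (Injective)
open import Relation.Binary.PropositionalEquality using (_≡_; _≢_; refl)

-- Finite simple graphs.
record Graph : Set where
  field
    order      : ℕ
    adj        : Fin order → Fin order → Bool
    adj-sym    : ∀ u v → adj u v ≡ adj v u
    adj-irrefl : ∀ v → adj v v ≡ false

  V : Set
  V = Fin order

  Adj : V → V → Set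
  Adj u v = T (adj u v)

  neighbourhood : V → Subset order
  neighbourhood v = tabulate (adj v)

  degree : V → ℕ
  degree v = ∣ neighbourhood v ∣

open Graph using (V; Adj)

-- Equal to 0 for the graph without vertices.
Δ : Graph → ℕ
Δ G = max 0 (map degree (allFin order))
  where open Graph G

Bipartite : Graph → Set
Bipartite G = Σ (V G → Bool) λ side → ∀ u v → Adj G u v → side u ≢ side v

K : ℕ → ℕ → Graph
K m n = record
  { order      = m + n
  ; adj        = λ u v → across (splitAt m u) (splitAt m v)
  ; adj-sym    = λ u v → across-sym (splitAt m u) (splitAt m v)
  ; adj-irrefl = λ v → across-irrefl (splitAt m v)
  }
  where
  across : Fin m ⊎ Fin n → Fin m ⊎ Fin n → Bool
  across (inj₁ _) (inj₂ _) = true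
  across (inj₂ _) (inj₁ _) = true
  across (inj₁ _) (inj₁ _) = false
  across (inj₂ _) (inj₂ _) = false

  across-sym : ∀ x y → across x y ≡ across y x
  across-sym (inj₁ _) (inj₁ _) = refl
  across-sym (inj₁ _) (inj₂ _) = refl
  across-sym (inj₂ _) (inj₁ _) = refl
  across-sym (inj₂ _) (inj₂ _) = refl

  across-irrefl : ∀ x → across x x ≡ false
  across-irrefl (inj₁ _) = refl
  across-irrefl (inj₂ _) = refl

-- Colours are attached to ordered pairs of adjacent vertices; symmetry makes
-- this a colouring of the undirected edges.
record EdgeColouring (s : ℕ) (H : Graph) : Set where
  field
    colour     : ∀ u v → Adj H u v → Fin s
    colour-sym : ∀ u v (e : Adj H u v) (e′ : Adj H v u) →
                 colour u v e ≡ colour v u e′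

-- The subgraph is not required to be induced: it consists of the images of the
-- vertices and edges of G under an injective homomorphism.
MonochromaticCopy : ∀ {s} (G H : Graph) → EdgeColouring s H → Set
MonochromaticCopy {s} G H χ =
  Σ (V G → V H) λ φ → Injective _≡_ _≡_ φ ×
  ∃[ i ] (∀ u v → Adj G u v →
          Σ (Adj H (φ u) (φ v)) λ e → colour (φ u) (φ v) e ≡ i)
  where open EdgeColouring χ

infix 4 _⟶[_]_

_⟶[_]_ : Graph → ℕ → Graph → Set
H ⟶[ s ] G = (χ : EdgeColouring s H) → MonochromaticCopy G H χ

-- k = min { f a ∣ P a }.  Minima are specified by a predicate because the
-- minimum of a set of naturals that is not known to be decidable cannot be
-- computed constructively.
IsMinimum : {A : Set} → (A → ℕ) → (A → Set) → ℕ → Set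
IsMinimum f P k = (∃[ a ] (P a × f a ≡ k)) × (∀ a → P a → k ≤ f a)

Is-rΔ : Graph → ℕ → ℕ → Set
Is-rΔ G s = IsMinimum Δ (λ H → H ⟶[ s ] G)

Is-brΔ : Graph → ℕ → ℕ → Set
Is-brΔ G s = IsMinimum Δ (λ H → Bipartite H × H ⟶[ s ] G)

fromℕ : ℕ → ℚ
fromℕ n = + n / 1

-- Every H with H ⟶[ s ] K m n contains K m n, hence a vertex of degree at
-- least n.  Conversely K a (sᵃ n) with a = s m arrows K m n: sᵃ n vertices on
-- the right admit only sᵃ colour patterns towards the left, so n of them share
-- a pattern, and this pattern takes some colour on m of the a left vertices.
{-# OPTIONS --safe #-}
module Submission where

open import Defs
open import Data.Bool using (Bool; true; false)
open import Data.Bool.Properties using (T-≡)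
open import Data.Fin using (Fin; zero; suc; _↑ˡ_; _↑ʳ_; _≟_; fromℕ<; funToFin; finToFun; inject≤; join; punchOut; splitAt)
open import Data.Fin.Properties using (0≢1+n; finToFun-funToFin; inject≤-injective; join-splitAt; punchIn-punchOut; splitAt-join; splitAt-↑ʳ; splitAt-↑ˡ; suc-injective; ↑ʳ-injective)
open import Data.Fin.Subset using (Subset; _∈_; _-_; ∣_∣)
open import Data.Fin.Subset.Properties using (x∈p∧x≢y⇒x∈p-y; x∈p⇒∣p-x∣<∣p∣; ∣p∣≤n)
open import Data.Integer using (+_; +≤+)
import Data.Integer.Properties as ℤ
open import Data.List.Extrema.Nat using (max≤v⁺; xs≤max)
open import Data.List.Membership.Propositional.Properties using (∈-allFin; ∈-map⁺)
import Data.List.Relation.Unary.All as All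
import Data.List.Relation.Unary.All.Properties as All
open import Data.Nat using (ℕ; zero; suc; NonZero; _+_; _*_; _^_; _⊔_; _≤_; _<_; z≤n; s≤s; >-nonZero⁻¹)
import Data.Nat.Coprimality as Coprimality
open import Data.Nat.Induction using (<-rec)
open import Data.Nat.Properties using (*-identityˡ; +-suc; +-identityʳ; m≤m⊔n; m≤n⊔m; m≤n*m; m^n≢0; m^n>0; ≤-refl; ≤-trans; ≤-<-trans; ≮⇒≥; ⊔-lub)
open import Data.Product using (_×_; ∃-syntax; _,_; proj₁)
open import Data.Rational using (ℚ; 0ℚ; 1ℚ; mkℚ; *≤*) renaming (_<_ to _<ℚ_; _≤_ to _≤ℚ_; _*_ to _*ℚ_; _/_ to _/ℚ_)
import Data.Rational.Properties as ℚ
open import Data.Sum as Sum using (_⊎_; inj₁; inj₂)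
open import Data.Sum.Properties using (inj₁-injective; inj₂-injective)
open import Data.Unit using (tt)
open import Data.Vec using (tabulate)
open import Data.Vec.Properties using (lookup∘tabulate; lookup⇒[]=)
open import Function using (Equivalence; Injective; _∘_)
open import Relation.Binary.PropositionalEquality using (_≡_; _≢_; refl; sym; trans; cong; cong₂; subst)
open import Relation.Nullary using (¬_; yes; no)
open import Relation.Unary using (Decidable; ∁)

open Graph using (Adj)

-- An injection rather than a subset of size `n`: repeated selections compose as functions, and the
-- result can serve directly as a vertex map.
Selection : {A : Set} → ℕ → (A → Set) → Set
Selection {A} n P = ∃[ g ] (Injective {A = Fin n} {B = A} _≡_ _≡_ g × ∀ i → P (g i))

module _ {N : ℕ} (P : Fin (suc N) → Set) where

  weaken : ∀ {n} → Selection n (P ∘ suc) → Selection n P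
  weaken (g , g-inj , Pg) = suc ∘ g , g-inj ∘ suc-injective , Pg

  extend : ∀ {n} → P zero → Selection n (P ∘ suc) → Selection (suc n) P
  extend {n} P₀ (g , g-inj , Pg) = h , h-inj , Ph
    where
    h : Fin (suc n) → Fin (suc N)
    h zero    = zero
    h (suc i) = suc (g i)

    h-inj : Injective _≡_ _≡_ h
    h-inj {zero}  {zero}  _  = refl
    h-inj {suc _} {suc _} eq = cong suc (g-inj (suc-injective eq))

    Ph : ∀ i → P (h i)
    Ph zero    = P₀
    Ph (suc i) = Pg i

empty : {A : Set} (P : A → Set) → Selection 0 P
empty P = (λ ()) , (λ { {()} }) , λ ()

-- Each element scanned lowers one of the two demands `a` and `b` by one, so one demand is met
-- before the elements run out.
split : ∀ {N} {P : Fin N → Set} → Decidable P → ∀ a b → a + b ≤ N →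
        Selection a P ⊎ Selection b (∁ P)
split {P = P} P? zero    _       _       = inj₁ (empty P)
split {P = P} P? (suc _) zero    _       = inj₂ (empty (∁ P))
split {suc N} {P} P? (suc a) (suc b) (s≤s a+b≤N) with P? zero
... | yes P₀ = Sum.map (extend P P₀) (weaken (∁ P)) (split (P? ∘ suc) a (suc b) a+b≤N)
... | no ¬P₀ = Sum.map (weaken P) (extend (∁ P) ¬P₀)
                 (split (P? ∘ suc) (suc a) b (subst (_≤ N) (+-suc a b) a+b≤N))

-- Induction on the number of colours: either `n` elements have colour zero, or enough elements
-- avoid it and `punchOut` removes that colour. The base case is one colour, since with none there
-- is no `i` to return.
pigeonhole-suc : ∀ {N} k n (f : Fin N → Fin (suc k)) → suc k * n ≤ N →
                 ∃[ i ] Selection n (λ x → f x ≡ i)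
pigeonhole-suc zero n f le =
  zero , (λ i → inject≤ i n≤N) , inject≤-injective n≤N n≤N _ _ , λ _ → Fin1-unique _
  where
  n≤N = subst (_≤ _) (*-identityˡ n) le

  Fin1-unique : ∀ (i : Fin 1) → i ≡ zero
  Fin1-unique zero = refl
-- `suc (suc k) * n` unfolds to `n + suc k * n`, and `zero ≟ f x` is oriented as `punchOut`
-- requires.
pigeonhole-suc (suc k) n f le with split (λ x → zero ≟ f x) n (suc k * n) le
... | inj₁ (g , g-inj , 0≡fg) = zero , g , g-inj , sym ∘ 0≡fg
... | inj₂ (g , g-inj , 0≢fg) =
  let i , h , h-inj , eq = pigeonhole-suc k n (λ x → punchOut (0≢fg x)) ≤-refl in
  suc i , g ∘ h , h-inj ∘ g-inj ,
  λ x → trans (sym (punchIn-punchOut (0≢fg (h x)))) (cong suc (eq x))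

pigeonhole : ∀ {N} k .{{_ : NonZero k}} n (f : Fin N → Fin k) → k * n ≤ N →
             ∃[ i ] Selection n (λ x → f x ≡ i)
pigeonhole (suc k) = pigeonhole-suc k

-- Deleting `g zero` makes `p` strictly smaller, and by injectivity the other selected elements
-- survive.
selection≤∣p∣ : ∀ {N n} (p : Subset N) → Selection n (_∈ p) → n ≤ ∣ p ∣
selection≤∣p∣ {n = zero}  p _ = z≤n
selection≤∣p∣ {n = suc n} p (g , g-inj , g∈p) =
  ≤-<-trans (selection≤∣p∣ (p - g zero) (g ∘ suc , suc-injective ∘ g-inj , rest∈))
            (x∈p⇒∣p-x∣<∣p∣ (g∈p zero))
  where
  rest∈ : ∀ i → g (suc i) ∈ p - g zero
  rest∈ i = x∈p∧x≢y⇒x∈p-y (g∈p (suc i)) (0≢1+n ∘ sym ∘ g-inj)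

-- Used to count a neighbourhood in `K m n` side by side.
∣tabulate-+∣ : ∀ a {b} (f : Fin (a + b) → Bool) →
               ∣ tabulate f ∣ ≡ ∣ tabulate (f ∘ (_↑ˡ b)) ∣ + ∣ tabulate (f ∘ (a ↑ʳ_)) ∣
∣tabulate-+∣ zero    f = refl
∣tabulate-+∣ (suc a) f with f zero
... | true  = cong suc (∣tabulate-+∣ a (f ∘ suc))
... | false = ∣tabulate-+∣ a (f ∘ suc)

∣tabulate-false∣ : ∀ {n} (f : Fin n → Bool) → (∀ i → f i ≡ false) → ∣ tabulate f ∣ ≡ 0
∣tabulate-false∣ {zero}  f f≡false = refl
∣tabulate-false∣ {suc n} f f≡false rewrite f≡false zero = ∣tabulate-false∣ (f ∘ suc) (f≡false ∘ suc)

degree≤Δ : ∀ H v → Graph.degree H v ≤ Δ H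
degree≤Δ H v = All.lookup (xs≤max 0 _) (∈-map⁺ (Graph.degree H) (∈-allFin v))

Δ≤ : ∀ H {d} → (∀ v → Graph.degree H v ≤ d) → Δ H ≤ d
Δ≤ H deg≤d = max≤v⁺ z≤n (All.map⁺ (All.tabulate⁺ deg≤d))

neighbours≤Δ : ∀ H v {n} → Selection n (Adj H v) → n ≤ Δ H
neighbours≤Δ H v (g , g-inj , adj) = ≤-trans
  (selection≤∣p∣ (Graph.neighbourhood H v) (g , g-inj , λ i →
    lookup⇒[]= (g i) _ (trans (lookup∘tabulate _ (g i)) (Equivalence.to T-≡ (adj i)))))
  (degree≤Δ H v)

module _ (m n : ℕ) where

  K-adjˡʳ : ∀ i j → Adj (K m n) (i ↑ˡ n) (m ↑ʳ j)
  K-adjˡʳ i j rewrite splitAt-↑ˡ m i n | splitAt-↑ʳ m n j = tt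

  K-adjʳˡ : ∀ i j → Adj (K m n) (m ↑ʳ j) (i ↑ˡ n)
  K-adjʳˡ i j rewrite splitAt-↑ˡ m i n | splitAt-↑ʳ m n j = tt

  K-nonadjˡˡ : ∀ i j → Graph.adj (K m n) (i ↑ˡ n) (j ↑ˡ n) ≡ false
  K-nonadjˡˡ i j rewrite splitAt-↑ˡ m i n | splitAt-↑ˡ m j n = refl

  K-nonadjʳʳ : ∀ i j → Graph.adj (K m n) (m ↑ʳ i) (m ↑ʳ j) ≡ false
  K-nonadjʳʳ i j rewrite splitAt-↑ʳ m n i | splitAt-↑ʳ m n j = refl

  degree-K : ∀ v → Graph.degree (K m n) v ≤ m ⊔ n
  -- Writing `v` as a `join` puts it on an explicit side; its own side then contributes no
  -- neighbours.
  degree-K v = subst (λ v → Graph.degree (K m n) v ≤ m ⊔ n) (join-splitAt m n v) (bound (splitAt m v))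
    where
    bound : ∀ x → Graph.degree (K m n) (join m n x) ≤ m ⊔ n
    bound (inj₁ i)
      rewrite ∣tabulate-+∣ m (Graph.adj (K m n) (i ↑ˡ n))
            | ∣tabulate-false∣ _ (K-nonadjˡˡ i)
      = ≤-trans (∣p∣≤n (tabulate (Graph.adj (K m n) (i ↑ˡ n) ∘ (m ↑ʳ_)))) (m≤n⊔m m n)
    bound (inj₂ j)
      rewrite ∣tabulate-+∣ m (Graph.adj (K m n) (m ↑ʳ j))
            | ∣tabulate-false∣ _ (K-nonadjʳʳ j)
            | +-identityʳ ∣ tabulate (λ i → Graph.adj (K m n) (m ↑ʳ j) (i ↑ˡ n)) ∣
      = ≤-trans (∣p∣≤n (tabulate (Graph.adj (K m n) (m ↑ʳ j) ∘ (_↑ˡ n)))) (m≤m⊔n m n)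

  Δ-K : Δ (K m n) ≤ m ⊔ n
  Δ-K = Δ≤ (K m n) degree-K

  K-bipartite : Bipartite (K m n)
  K-bipartite = side ∘ splitAt m , sides-differ
    where
    side : Fin m ⊎ Fin n → Bool
    side (inj₁ _) = true
    side (inj₂ _) = false

    sides-differ : ∀ u v → Adj (K m n) u v → side (splitAt m u) ≢ side (splitAt m v)
    sides-differ u v adj with splitAt m u | splitAt m v
    ... | inj₁ _ | inj₂ _ = λ ()
    ... | inj₂ _ | inj₁ _ = λ ()

constantColouring : ∀ {s} H → Fin s → EdgeColouring s H
constantColouring H i = record { colour = λ _ _ _ → i ; colour-sym = λ _ _ _ _ → refl }

-- A constant colouring already yields a copy of `K m n`, in which the image of one left vertex has
-- `n` distinct neighbours.
arrow⇒n≤Δ : ∀ m s .{{_ : NonZero m}} .{{_ : NonZero s}} n H → H ⟶[ s ] K m n → n ≤ Δ H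
arrow⇒n≤Δ m s n H H⟶K =
  let φ , φ-inj , _ , mono = H⟶K (constantColouring H (fromℕ< (>-nonZero⁻¹ s)))
      v = fromℕ< (>-nonZero⁻¹ m)
  in neighbours≤Δ H (φ (v ↑ˡ n))
       (φ ∘ (m ↑ʳ_) , ↑ʳ-injective m _ _ ∘ φ-inj , λ j → proj₁ (mono _ _ (K-adjˡʳ m n v j)))

module _ {s a b : ℕ} (χ : EdgeColouring s (K a b)) where
  open EdgeColouring χ

  crossColour : Fin a → Fin b → Fin s
  crossColour x y = colour (x ↑ˡ b) (a ↑ʳ y) (K-adjˡʳ a b x y)

  monochromatic-K : ∀ {m n} (g : Fin m → Fin a) (h : Fin n → Fin b) →
                    Injective _≡_ _≡_ g → Injective _≡_ _≡_ h →
                    ∀ c → (∀ i j → crossColour (g i) (h j) ≡ c) →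
                    MonochromaticCopy (K m n) (K a b) χ
  monochromatic-K {m} {n} g h g-inj h-inj c mono = φ , φ-inj , c , φ-mono
    where
    gh : Fin m ⊎ Fin n → Fin a ⊎ Fin b
    gh = Sum.map g h

    φ : Fin (m + n) → Fin (a + b)
    φ u = join a b (gh (splitAt m u))

    gh-inj : Injective _≡_ _≡_ gh
    gh-inj {inj₁ _} {inj₁ _} eq = cong inj₁ (g-inj (inj₁-injective eq))
    gh-inj {inj₂ _} {inj₂ _} eq = cong inj₂ (h-inj (inj₂-injective eq))

    φ-inj : Injective _≡_ _≡_ φ
    φ-inj {u} {v} eq = splitAt-inj (gh-inj (join-inj eq))
      where
      join-inj : ∀ {x y} → join a b x ≡ join a b y → x ≡ y
      join-inj {x} {y} e =
        trans (sym (splitAt-join a b x)) (trans (cong (splitAt a) e) (splitAt-join a b y))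

      splitAt-inj : splitAt m u ≡ splitAt m v → u ≡ v
      splitAt-inj e =
        trans (sym (join-splitAt m n u)) (trans (cong (join m n) e) (join-splitAt m n v))

    φ-mono : ∀ u v → Adj (K m n) u v →
             ∃[ e ] colour (φ u) (φ v) e ≡ c
    -- Abstracting the splits also reduces `φ u` and `φ v` to explicit sides and makes `adj` empty
    -- when the sides agree.
    φ-mono u v adj with splitAt m u | splitAt m v
    ... | inj₁ i | inj₂ j = K-adjˡʳ a b (g i) (h j) , mono i j
    ... | inj₂ j | inj₁ i =
      K-adjʳˡ a b (g i) (h j) , trans (colour-sym _ _ _ _) (mono i j)

K-arrow : ∀ m s .{{_ : NonZero s}} n → K (s * m) (s ^ (s * m) * n) ⟶[ s ] K m n
K-arrow m s n χ =
  let a = s * m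
      -- A colour pattern `Fin a → Fin s` is encoded by `funToFin` as one of `s ^ a` values, so that
      -- the pigeonhole applies to patterns.
      profile , h , h-inj , eq = pigeonhole (s ^ a) {{m^n≢0 s a}} n
        (λ y → funToFin (λ x → crossColour χ x y)) ≤-refl
      -- Decoded, the shared pattern is an `s`-colouring of the `s * m` left vertices.
      c , g , g-inj , eq′ = pigeonhole s m (finToFun profile) ≤-refl
  in monochromatic-K χ g h g-inj h-inj c λ i j →
       trans (sym (finToFun-funToFin _ (g i)))
             (trans (cong (λ p → finToFun p (g i)) (eq j)) (eq′ i))

-- If there were no minimum, strong induction on the value would refute `P` everywhere: once all
-- values below `k` are excluded, an element of value `k` would be a minimum.
¬¬minimum : ∀ {A : Set} (f : A → ℕ) (P : A → Set) a → P a → ¬ ¬ (∃[ k ] IsMinimum f P k)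
¬¬minimum {A} f P a Pa ¬min = <-rec (λ k → ∀ a → f a ≡ k → ¬ P a) step (f a) a refl Pa
  where
  step : ∀ k → (∀ {j} → j < k → ∀ a → f a ≡ j → ¬ P a) → ∀ a → f a ≡ k → ¬ P a
  step k below a fa≡k Pa =
    ¬min (k , (a , Pa , fa≡k) , λ a′ Pa′ → ≮⇒≥ λ fa′<k → below fa′<k a′ refl Pa′)

-- `_/_` normalises by a gcd that is stuck on a variable; the explicit fraction lets order and
-- product compute.
fromℕ≡mkℚ : ∀ n → fromℕ n ≡ mkℚ (+ n) 0 (Coprimality.sym (Coprimality.1-coprimeTo n))
fromℕ≡mkℚ n = ℚ.normalize-coprime (Coprimality.sym (Coprimality.1-coprimeTo n))

fromℕ-mono-≤ : ∀ {m n} → m ≤ n → fromℕ m ≤ℚ fromℕ n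
fromℕ-mono-≤ {m} {n} m≤n rewrite fromℕ≡mkℚ m | fromℕ≡mkℚ n =
  *≤* (ℤ.*-monoʳ-≤-nonNeg (+ 1) (+≤+ m≤n))

fromℕ-* : ∀ m n → fromℕ (m * n) ≡ fromℕ m *ℚ fromℕ n
fromℕ-* m n = trans (cong (_/ℚ 1) (ℤ.pos-* m n))
  (sym (cong₂ _*ℚ_ (fromℕ≡mkℚ m) (fromℕ≡mkℚ n)))

theorem3 : ∀ (m s : ℕ) .{{_ : NonZero m}} .{{_ : NonZero s}} →
    ∃[ c ] ∃[ C ] (0ℚ <ℚ c × 0ℚ <ℚ C ×
    (∃[ N ] ∀ (n : ℕ) → N ≤ n →
    (¬ ¬ (∃[ r ] Is-rΔ (K m n) s r)) ×
    (¬ ¬ (∃[ b ] Is-brΔ (K m n) s b)) ×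
    (∀ (r b : ℕ) → Is-rΔ (K m n) s r → Is-brΔ (K m n) s b →
    (c *ℚ fromℕ n ≤ℚ fromℕ r) × (r ≤ b) × (fromℕ b ≤ℚ C *ℚ fromℕ n))))
theorem3 m s =
  -- The constants are `c = 1` and `C = s ^ (s * m)`, with threshold `N = s * m`.
  1ℚ , fromℕ M , ℚ.positive⁻¹ 1ℚ ,
  ℚ.<-≤-trans (ℚ.positive⁻¹ 1ℚ) (fromℕ-mono-≤ (m^n>0 s a)) ,
  a , λ n a≤n →
    let H = K a (M * n)
        H-bip = K-bipartite a (M * n)
        H⟶K = K-arrow m s n
    in
    ¬¬minimum Δ _ H H⟶K ,
    ¬¬minimum Δ _ H (H-bip , H⟶K) ,
    λ { r b ((G , G⟶K , refl) , r-min) ((B , (_ , B⟶K) , refl) , b-min) →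
        subst (_≤ℚ fromℕ r) (sym (ℚ.*-identityˡ (fromℕ n))) (fromℕ-mono-≤ (arrow⇒n≤Δ m s n G G⟶K)) ,
        -- An optimal bipartite graph also competes in the minimum over all graphs.
        r-min B B⟶K ,
        subst (fromℕ b ≤ℚ_) (fromℕ-* M n) (fromℕ-mono-≤
          (≤-trans (b-min H (H-bip , H⟶K))
            (≤-trans (Δ-K a (M * n))
              -- Beyond the threshold `a ≤ n ≤ M * n`, so the right side is the larger one and
              -- bounds the degree.
              (⊔-lub (≤-trans a≤n (m≤n*m n M {{m^n≢0 s a}})) ≤-refl)))) }
  where
  a = s * m
  M = s ^ a
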